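{- Let $\mathfrak K=(K,R,{}^*,\{0\})$ be a frame (so $0\in K$). (1) $\mathfrak K$ is a $\mathsf{CR}^*$-frame satisfying left reflection ($Rxyz\Rightarrow Rx^*zy$ for all $x,y,z\in K$) if and only if $\mathfrak{Cm}(\mathfrak K)$ is a dense commutative relation algebra. (2) $\mathfrak K$ is a $\mathsf{KR}$-frame if and only if $\mathfrak{Cm}(\mathfrak K)$ is a dense symmetric relation algebra.
   Context: A frame is $\mathfrak K=(K,R,{}^*,\mathcal I)$ with $K$ a set, $R\subseteq K^3$, ${}^*\colon K\to K$, $\mathcal I\subseteq K$. Its complex algebra $\mathfrak{Cm}(\mathfrak K)$ is $(\wp(K),\cup,\overline{\phantom a},;,{}^\smile,\mathcal I)$ with $\overline X=K\setminus X$, $X;Y=\{z:Rxyz\text{ for some }x\in X,y\in Y\}$, $X^\smile=\{z^*:z\in X\}$. A $\mathsf{CR}^*$-frame is a frame with $\mathcal I=\{0\}$ such that for all $a,b,c,d\in K$: (p1) $R0ab\Leftrightarrow a=b$; (p2) $\exists x(Rabx\land Rxcd)\Leftrightarrow\exists y(Racy\land Rybd)$; (p3) $Raaa$; (p4) $a^{**}=a$; (p5) $Rabc\Leftrightarrow Rac^*b^*$. A $\mathsf{KR}$-frame is a $\mathsf{CR}^*$-frame with $x^*=x$ for all $x\in K$. A relation algebra is an algebra $(U,+,\overline{\phantom a},;,{}^\smile,1')$ satisfying, for all $a,b,c\in U$: $a+b=b+a$; $a+(b+c)=(a+b)+c$; $\overline{\overline a+\overline b}+\overline{\overline a+b}=a$;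 $a;(b;c)=(a;b);c$; $(a+b);c=a;c+b;c$; $a;1'=a$; $a^{\smile\smile}=a$; $(a+b)^\smile=a^\smile+b^\smile$; $(a;b)^\smile=b^\smile;a^\smile$; $a^\smile;\overline{a;b}+\overline b=\overline b$. Write $x\le y$ for $x+y=y$. The algebra is dense if $x\le x;x$ for all $x$, commutative if $x;y=y;x$ for all $x,y$, symmetric if $x^\smile=x$ for all $x$. -}

module Defs where

open import Algebra.Core using (Op₁; Op₂)
import Algebra.Definitions
import Algebra.Structures
open import Data.Product using (_×_; ∃-syntax)
open import Function.Bundles using (_⇔_)
open import Level using (Level; suc; _⊔_)
open import Relation.Binary.Core using (Rel)
open import Relation.Binary.PropositionalEquality using (_≡_)
open import Relation.Unary using (Pred; _≐_; _∪_; ∁; ｛_｝)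

private
  variable
    c ℓ : Level

record Frame ℓ : Set (suc ℓ) where
  infix 25 _*
  field
    K  : Set ℓ
    R  : K → K → K → Set ℓ
    _* : K → K
    𝓘  : Pred K ℓ

record IsCR*Frame (𝔎 : Frame ℓ) (o : Frame.K 𝔎) : Set ℓ where
  open Frame 𝔎
  field
    𝓘≐｛o｝ : 𝓘 ≐ ｛ o ｝
    p1 : ∀ a b → R o a b ⇔ a ≡ b
    p2 : ∀ a b c d → (∃[ x ] (R a b x × R x c d)) ⇔ (∃[ y ] (R a c y × R y b d))
    p3 : ∀ a → R a a a
    p4 : ∀ a → a * * ≡ a
    p5 : ∀ a b c → R a b c ⇔ R a (c *) (b *)

record IsKRFrame (𝔎 : Frame ℓ) (o : Frame.K 𝔎) : Set ℓ where
  open Frame 𝔎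
  field
    isCR*Frame : IsCR*Frame 𝔎 o
    *-identity : ∀ x → x * ≡ x

  open IsCR*Frame isCR*Frame public

LeftReflection : Frame ℓ → Set ℓ
LeftReflection 𝔎 = ∀ x y z → R x y z → R (x *) z y
  where open Frame 𝔎

-- The signature (U , + , ‾ , ; , ˘ , 1′), with the equality of U as a setoid
-- relation so that subsets can be compared extensionally.  Complement is
-- written -_ and, ";" being reserved, relative product is written _⨾_.
record RawRelationAlgebra c ℓ : Set (suc (c ⊔ ℓ)) where
  infix  4 _≈_ _≤_
  infixl 6 _+_
  infixl 7 _⨾_
  infix  8 -_
  infix  9 _˘
  field
    U   : Set c
    _≈_ : Rel U ℓ
    _+_ : Op₂ U
    -_  : Op₁ U
    _⨾_ : Op₂ U
    _˘  : Op₁ U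
    1′  : U

  _≤_ : Rel U ℓ
  x ≤ y = x + y ≈ y

module _ (𝔄 : RawRelationAlgebra c ℓ) where
  open RawRelationAlgebra 𝔄
  open Algebra.Definitions _≈_
  open Algebra.Structures _≈_ using (IsCommutativeSemigroup)

  -- No axiom is assumed for _+_ and -_ beyond Huntington's basis for Boolean
  -- algebras.
  record IsRelationAlgebra : Set (c ⊔ ℓ) where
    field
      -- equivalence, congruence, associativity and commutativity
      +-isCommutativeSemigroup : IsCommutativeSemigroup _+_
      -‿cong        : Congruent₁ -_
      ⨾-cong        : Congruent₂ _⨾_
      ˘-cong        : Congruent₁ _˘
      huntington    : ∀ a b → - (- a + - b) + - (- a + b) ≈ a
      ⨾-assoc       : Associative _⨾_
      ⨾-distribʳ-+  : _⨾_ DistributesOverʳ _+_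
      ⨾-identityʳ   : RightIdentity 1′ _⨾_
      ˘-involutive  : Involutive _˘
      ˘-distrib-+   : ∀ a b → (a + b) ˘ ≈ a ˘ + b ˘
      ˘-anti-⨾      : ∀ a b → (a ⨾ b) ˘ ≈ b ˘ ⨾ a ˘
      tarski        : ∀ a b → a ˘ ⨾ - (a ⨾ b) + - b ≈ - b

  IsDense : Set (c ⊔ ℓ)
  IsDense = ∀ x → x ≤ x ⨾ x

  IsCommutative : Set (c ⊔ ℓ)
  IsCommutative = Commutative _⨾_

  IsSymmetric : Set (c ⊔ ℓ)
  IsSymmetric = ∀ x → x ˘ ≈ x

-- The powerset of K is Pred K ℓ under mutual inclusion.  Its complement
-- satisfies Huntington's equation only classically.
ℭ𝔪 : Frame ℓ → RawRelationAlgebra (suc ℓ) ℓ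
ℭ𝔪 {ℓ} 𝔎 = record
  { U   = Pred K ℓ
  ; _≈_ = _≐_
  ; _+_ = _∪_
  ; -_  = ∁
  ; _⨾_ = λ X Y z → ∃[ x ] ∃[ y ] (X x × Y y × R x y z)
  ; _˘  = λ X w → ∃[ z ] (X z × w ≡ z *)
  ; 1′  = 𝓘
  }
  where open Frame 𝔎

{-# OPTIONS --safe #-}

-- Both directions are correspondence theory on atoms.  The relation algebra
-- axioms, applied to singletons, are the frame conditions: p2 with a = 0 says
-- that composition commutes, after which p2 is associativity, and Tarski's
-- axiom is left reflection.  Given commutativity and left reflection, p5 is
-- equivalent to the anti-automorphism law Rxyz ⇒ Ry*x*z*.
module Submission where

open import Defs
open import Algebra.Structures using (module IsCommutativeSemigroup)
open import Axiom.DoubleNegationElimination using (em⇒dne)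
open import Axiom.ExcludedMiddle using (ExcludedMiddle)
open import Data.Product using (_×_; _,_; proj₁; proj₂; ∃-syntax)
open import Data.Sum using (inj₁; inj₂; [_,_]; swap; map; assocʳ; assocˡ)
open import Function using (id; _∘_)
open import Function.Bundles using (_⇔_; mk⇔; Equivalence)
open import Level using (Level)
open import Relation.Binary.PropositionalEquality using (_≡_; refl; sym; subst; subst₂)
open import Relation.Nullary using (yes; no)
open import Relation.Unary using (Pred; _≐_; _∪_; _∈_; ∁; ｛_｝)
open import Relation.Unary.Properties using (≐-refl; ≐-sym; ≐-trans)

open Equivalence using (to; from)

private
  variable
    ℓ : Level

module CR*FrameProperties {𝔎 : Frame ℓ} {o : Frame.K 𝔎} (isCR* : IsCR*Frame 𝔎 o) where
  open Frame 𝔎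
  open IsCR*Frame isCR*

  -- By p2 the pair `R o x x`, `R x y z` becomes `R o y w`, `R w x z`, and p1 identifies `w` with
  -- `y`.
  R-comm : ∀ {x y z} → R x y z → R y x z
  R-comm {x} {y} {z} r with to (p2 o x y z) (x , from (p1 x x) refl , r)
  ... | w , roy , rwx = subst (λ v → R v x z) (sym (to (p1 y w) roy)) rwx

  R-identityʳ : ∀ {x z} → R x o z → x ≡ z
  R-identityʳ = to (p1 _ _) ∘ R-comm

  -- Once the first triple is commuted to `R b a x`, p2 exchanges `a` and `c`; commuting the last
  -- triple then turns the exchange into rebracketing.
  R-assocʳ : ∀ {a b c d x} → R a b x → R x c d → ∃[ y ] (R b c y × R a y d)
  R-assocʳ rabx rxcd with to (p2 _ _ _ _) (_ , R-comm rabx , rxcd)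
  ... | y , rbcy , ryad = y , rbcy , R-comm ryad

  R-assocˡ : ∀ {a b c d y} → R b c y → R a y d → ∃[ x ] (R a b x × R x c d)
  R-assocˡ rbcy rayd with from (p2 _ _ _ _) (_ , rbcy , R-comm rayd)
  ... | x , rbax , rxcd = x , R-comm rbax , rxcd

  module _ (reflectˡ : LeftReflection 𝔎) where

    -- First p5 stars the last two arguments while exchanging them; left reflection then exchanges
    -- them back and stars the first.
    R-anti-* : ∀ {x y z} → R x y z → R (y *) (x *) (z *)
    R-anti-* = R-comm ∘ reflectˡ _ _ _ ∘ to (p5 _ _ _)

    ℭ𝔪-isRelationAlgebra : ExcludedMiddle ℓ → IsRelationAlgebra (ℭ𝔪 𝔎)
    ℭ𝔪-isRelationAlgebra em = record
      { +-isCommutativeSemigroup = record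
        { isSemigroup = record
          { isMagma = record
            { isEquivalence = record { refl = ≐-refl ; sym = ≐-sym ; trans = ≐-trans }
            ; ∙-cong = λ (f , f′) (g , g′) → map f g , map f′ g′
            }
          ; assoc = λ _ _ _ → assocʳ , assocˡ
          }
        ; comm = λ _ _ → swap , swap
        }
      ; -‿cong = λ (f , f′) → (_∘ f′) , (_∘ f)
      ; ⨾-cong = λ (f , f′) (g , g′) →
            (λ (x , y , ax , by , r) → x , y , f ax , g by , r)
          , (λ (x , y , ax , by , r) → x , y , f′ ax , g′ by , r)
      ; ˘-cong = λ (f , f′) →
            (λ (z , az , eq) → z , f az , eq)
          , (λ (z , az , eq) → z , f′ az , eq)
      -- Membership in either complement refutes `∁ a`, so double negation elimination recovers `a`;
      -- for the converse, `split` decides membership in `b`.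
      ; huntington = λ a b → [ dne ∘ (_∘ inj₁) , dne ∘ (_∘ inj₁) ] , split a b
      ; ⨾-assoc = λ _ _ _ →
            (λ (x , c , (a , b , Aa , Bb , r) , Cc , s) →
              let y , r′ , s′ = R-assocʳ r s in a , y , Aa , (b , c , Bb , Cc , r′) , s′)
          , (λ (a , y , Aa , (b , c , Bb , Cc , r) , s) →
              let x , r′ , s′ = R-assocˡ r s in x , c , (a , b , Aa , Bb , r′) , Cc , s′)
      ; ⨾-distribʳ-+ = λ _ _ _ →
            (λ { (x , y , inj₁ Bx , Ay , r) → inj₁ (x , y , Bx , Ay , r)
               ; (x , y , inj₂ Cx , Ay , r) → inj₂ (x , y , Cx , Ay , r) })
          , [ (λ (x , y , Bx , Ay , r) → x , y , inj₁ Bx , Ay , r)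
            , (λ (x , y , Cx , Ay , r) → x , y , inj₂ Cx , Ay , r) ]
      ; ⨾-identityʳ = λ A →
            (λ (x , y , Ax , Iy , r) →
              subst A (R-identityʳ (subst (λ v → R x v _) (sym (proj₁ 𝓘≐｛o｝ Iy)) r)) Ax)
          , (λ Az → _ , o , Az , proj₂ 𝓘≐｛o｝ refl , R-comm (from (p1 _ _) refl))
      ; ˘-involutive = λ A →
            (λ { (_ , (z , Az , refl) , refl) → subst A (sym (p4 z)) Az })
          , (λ {w} Aw → w * , (w , Aw , refl) , sym (p4 w))
      ; ˘-distrib-+ = λ _ _ →
            (λ { (z , inj₁ Az , eq) → inj₁ (z , Az , eq)
               ; (z , inj₂ Bz , eq) → inj₂ (z , Bz , eq) })
          , [ (λ (z , Az , eq) → z , inj₁ Az , eq)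
            , (λ (z , Bz , eq) → z , inj₂ Bz , eq) ]
      ; ˘-anti-⨾ = λ _ _ →
            (λ { (_ , (x , y , Ax , By , r) , refl) →
                 y * , x * , (y , By , refl) , (x , Ax , refl) , R-anti-* r })
          -- Reversing `R (y *) (x *) w` yields a product triple ending in `w *`, and p4 makes `w`
          -- the star of that point.
          , (λ { {w} (_ , _ , (y , By , refl) , (x , Ax , refl) , r) →
                 w * , (x , y , Ax , By , subst₂ (λ u v → R u v (w *)) (p4 x) (p4 y) (R-anti-* r))
                     , sym (p4 w) })
      ; tarski = λ _ _ →
            -- The triple `R (x *) y w` reflects to `R x w y`, which puts `y` into the product that
            -- it was assumed to avoid.
            [ (λ { (_ , y , (x , Ax , refl) , ¬AB , r) Bw →
                   ¬AB (x , _ , Ax , Bw , subst (λ v → R v _ y) (p4 x) (reflectˡ _ _ _ r)) })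
            , id ]
          , inj₂
      }
      where
      dne = em⇒dne em

      split : ∀ (A B : Pred K ℓ) {w} → w ∈ A → w ∈ ∁ (∁ A ∪ ∁ B) ∪ ∁ (∁ A ∪ B)
      split A B {w} Aw with em {B w}
      ... | yes Bw = inj₁ [ (λ ¬Aw → ¬Aw Aw) , (λ ¬Bw → ¬Bw Bw) ]
      ... | no ¬Bw = inj₂ [ (λ ¬Aw → ¬Aw Aw) , ¬Bw ]

  ℭ𝔪-dense : IsDense (ℭ𝔪 𝔎)
  ℭ𝔪-dense _ = [ (λ Xw → _ , _ , Xw , Xw , p3 _) , id ] , inj₂

  ℭ𝔪-comm : IsCommutative (ℭ𝔪 𝔎)
  ℭ𝔪-comm _ _ = flipped , flipped
    where
    flipped : ∀ {X Y : Pred K ℓ} {z} → ∃[ x ] ∃[ y ] (X x × Y y × R x y z) → ∃[ y ] ∃[ x ] (Y y × X x × R y x z)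
    flipped (x , y , Xx , Yy , r) = y , x , Yy , Xx , R-comm r

module ComplexAlgebraProperties
  (em : ExcludedMiddle ℓ) {𝔎 : Frame ℓ} {o : Frame.K 𝔎} (𝓘≐｛o｝ : Frame.𝓘 𝔎 ≐ ｛ o ｝)
  (isRA : IsRelationAlgebra (ℭ𝔪 𝔎)) (⨾-comm : IsCommutative (ℭ𝔪 𝔎))
  where
  open Frame 𝔎
  open IsRelationAlgebra isRA

  *-involutive : ∀ a → a * * ≡ a
  *-involutive a with proj₂ (˘-involutive ｛ a ｝) refl
  ... | _ , (_ , refl , refl) , a≡a** = sym a≡a**

  R-comm : ∀ {x y z} → R x y z → R y x z
  R-comm {x} {y} r with proj₁ (⨾-comm ｛ x ｝ ｛ y ｝) (x , y , refl , refl , r)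
  ... | _ , _ , refl , refl , s = s

  R-identityˡ : ∀ a b → R o a b ⇔ a ≡ b
  R-identityˡ a b = mk⇔
    (λ r → proj₁ (⨾-identityʳ ｛ a ｝) (a , o , refl , proj₂ 𝓘≐｛o｝ refl , R-comm r))
    λ { refl → unit }
    where
    unit : R o a a
    unit with proj₂ (⨾-identityʳ ｛ a ｝) refl
    ... | _ , _ , refl , Iy , r = R-comm (subst (λ v → R a v a) (sym (proj₁ 𝓘≐｛o｝ Iy)) r)

  -- Rebracketing `(b ⨾ a) ⨾ c` as `b ⨾ (a ⨾ c)` on singletons yields `y` from the inner product.
  -- Swapping the roles of `b` and `c` gives the converse, so both directions of p2 follow.
  R-exchange : ∀ {a b c d} → ∃[ x ] (R a b x × R x c d) → ∃[ y ] (R a c y × R y b d)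
  R-exchange {a} {b} {c} (x , rabx , rxcd)
    with proj₁ (⨾-assoc ｛ b ｝ ｛ a ｝ ｛ c ｝)
           (x , c , (b , a , refl , refl , R-comm rabx) , refl , rxcd)
  ... | _ , y , refl , (_ , _ , refl , refl , racy) , rbyd = y , racy , R-comm rbyd

  leftReflection : LeftReflection 𝔎
  leftReflection x y z r = em⇒dne em λ ¬r →
    -- If `R (x *) z y` failed, `y` would lie outside `｛ x * ｝ ⨾ ｛ z ｝`. As `x` equals `x * *`, the
    -- triple `R x y z` would then make Tarski's law exclude `z` from `｛ z ｝`.
    proj₁ (tarski ｛ x * ｝ ｛ z ｝)
      (inj₁ (x * * , y , (x * , refl , refl)
            , (λ { (_ , _ , refl , refl , r′) → ¬r r′ })
            , subst (λ v → R v y z) (sym (*-involutive x)) r))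
      refl

  R-anti-* : ∀ {x y z} → R x y z → R (y *) (x *) (z *)
  R-anti-* {x} {y} {z} r
    with proj₁ (˘-anti-⨾ ｛ x ｝ ｛ y ｝) (z , (x , y , refl , refl , r) , refl)
  ... | _ , _ , (_ , refl , refl) , (_ , refl , refl) , s = s

  -- Left reflection gives `R (a *) c b`; reversing and commuting it gives `R (a * *) (c *) (b *)`.
  reflectʳ : ∀ {a b c} → R a b c → R a (c *) (b *)
  reflectʳ {a} {b} {c} r =
    subst (λ v → R v (c *) (b *)) (*-involutive a) (R-comm (R-anti-* (leftReflection _ _ _ r)))

  isCR*Frame : IsDense (ℭ𝔪 𝔎) → IsCR*Frame 𝔎 o
  isCR*Frame dense = record
    { 𝓘≐｛o｝ = 𝓘≐｛o｝
    ; p1 = R-identityˡ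
    ; p2 = λ _ _ _ _ → mk⇔ R-exchange R-exchange
    ; p3 = R-refl
    ; p4 = *-involutive
    -- Two applications of `reflectʳ` star `b` and `c` twice and restore their order, so by
    -- involution it is its own converse.
    ; p5 = λ a b c → mk⇔ reflectʳ
        (subst₂ (R a) (*-involutive b) (*-involutive c) ∘ reflectʳ)
    }
    where
    R-refl : ∀ a → R a a a
    R-refl a with proj₁ (dense ｛ a ｝) (inj₁ refl)
    ... | _ , _ , refl , refl , r = r

-- When the star is trivial, p5 and left reflection both say that the last two arguments of `R` may
-- be exchanged.
KR⇒leftReflection : {𝔎 : Frame ℓ} {o : Frame.K 𝔎} → IsKRFrame 𝔎 o → LeftReflection 𝔎
KR⇒leftReflection {𝔎 = 𝔎} isKR x y z r = subst (λ v → R v z y) (sym (*-identity x))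
  (subst₂ (R x) (*-identity z) (*-identity y) (to (p5 x y z) r))
  where
  open Frame 𝔎
  open IsKRFrame isKR

*-identity⇔symmetric : (𝔎 : Frame ℓ) → (∀ x → Frame._* 𝔎 x ≡ x) ⇔ IsSymmetric (ℭ𝔪 𝔎)
*-identity⇔symmetric 𝔎 = mk⇔
  (λ *-id X →
      (λ { (z , Xz , refl) → subst X (sym (*-id z)) Xz })
    , (λ {w} Xw → w , Xw , sym (*-id w)))
  (λ symm x → sym (proj₁ (symm ｛ x ｝) (x , refl , refl)))

-- When every element is its own converse, the anti-automorphism law `˘-anti-⨾` becomes
-- commutativity. This reduces the algebraic side of the symmetric case to the commutative one.
symmetric⇒commutative : ∀ {c ℓ} {𝔄 : RawRelationAlgebra c ℓ} →
  IsRelationAlgebra 𝔄 → IsSymmetric 𝔄 → IsCommutative 𝔄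
symmetric⇒commutative isRA symm x y =
  ≈-trans (≈-sym (symm _)) (≈-trans (˘-anti-⨾ x y) (⨾-cong (symm y) (symm x)))
  where
  open IsRelationAlgebra isRA
  open IsCommutativeSemigroup +-isCommutativeSemigroup using () renaming (sym to ≈-sym; trans to ≈-trans)

theorem14 : ∀ {ℓ} → ExcludedMiddle ℓ →
    (𝔎 : Frame ℓ) (o : Frame.K 𝔎) → Frame.𝓘 𝔎 ≐ ｛ o ｝ →
    ((IsCR*Frame 𝔎 o × LeftReflection 𝔎)
    ⇔ (IsRelationAlgebra (ℭ𝔪 𝔎) × IsDense (ℭ𝔪 𝔎) × IsCommutative (ℭ𝔪 𝔎)))
    × (IsKRFrame 𝔎 o
    ⇔ (IsRelationAlgebra (ℭ𝔪 𝔎) × IsDense (ℭ𝔪 𝔎) × IsSymmetric (ℭ𝔪 𝔎)))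
theorem14 em 𝔎 o 𝓘≐｛o｝ =
    mk⇔
      (λ (isCR* , reflectˡ) →
          CR*⇒.ℭ𝔪-isRelationAlgebra isCR* reflectˡ em , CR*⇒.ℭ𝔪-dense isCR* , CR*⇒.ℭ𝔪-comm isCR*)
      (λ (isRA , dense , ⨾-comm) →
          RA⇒.isCR*Frame isRA ⨾-comm dense , RA⇒.leftReflection isRA ⨾-comm)
  , mk⇔
      (λ isKR →
          CR*⇒.ℭ𝔪-isRelationAlgebra (isCR*Frame isKR) (KR⇒leftReflection isKR) em
        , CR*⇒.ℭ𝔪-dense (isCR*Frame isKR)
        , to (*-identity⇔symmetric 𝔎) (*-identity isKR))
      (λ (isRA , dense , symm) → record
        { isCR*Frame = RA⇒.isCR*Frame isRA (symmetric⇒commutative isRA symm) dense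
        ; *-identity = from (*-identity⇔symmetric 𝔎) symm
        })
  where
  open IsKRFrame using (isCR*Frame; *-identity)
  module CR*⇒ = CR*FrameProperties {𝔎 = 𝔎} {o}
  module RA⇒ = ComplexAlgebraProperties em {𝔎} 𝓘≐｛o｝
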